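{- For $n\ge 3$, let $D_n$ be the $n$-vertex digraph with adjacency matrix $J-I$, where $J$ is the $n\times n$ all-ones matrix and $I$ is the $n\times n$ identity matrix. Then $$f(D_n)=f^*(D_n)=l(D_n)=l^*(D_n)=w(P(D_n))=n.$$
   Context: A digraph $D$ is finite with nonempty vertex set $V(D)$, and is identified with a relation $D\subseteq V(D)\times V(D)$ (its set of edges; loops are allowed, no multiple edges). Its adjacency matrix has entry $1$ in position $(u,v)$ if $uv$ is an edge and $0$ otherwise. $\overline{D}=(V(D)\times V(D))\setminus D$ is its complement. A digraph is a Ferrers digraph if its successor sets $\{u: vu\in E\}$, over all vertices $v$, are linearly ordered by inclusion; equivalently, its adjacency matrix has no $2\times 2$ permutation submatrix (two rows and two columns, not necessarily consecutive). The Ferrers dimension $f(D)$ is the minimum number of Ferrers digraphs on $V(D)$ whose intersection is $D$, equivalently the minimum number of Ferrers digraphs on $V(D)$ whose union is $\overline{D}$. $f^*(D)$ is the minimum number of pairwise disjoint Ferrers digraphs on $V(D)$ (as edge sets) whose union is $\overline{D}$. Trees are finite; a leaf is a vertex of degree 1. Subtrees are nonempty connected subgraphs. A subtree representation of $D$ in a host tree $T$ assigns to each vertex $v$ an ordered pair $(S_v,T_v)$ of subtrees of $T$ (source subtree and sink subtree) such that $uv$ is an edge of $D$ if and only if $S_u$ and $T_v$ have a common vertex (for all $u,v\in V(D)$, including $u=v$). The leafage $l(D)$ is the minimum number of leaves of a host tree in which $D$ has a subtree representation. The catch leafage $l^*(D)$ is the minimum number of leaves of a host tree in which $D$ has a subtree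 representation where every sink subtree $T_v$ is a single vertex. The incidence poset $P(D)$ is the collection of predecessor sets $\{u\in V(D): uv\in E(D)\}$, $v\in V(D)$, ordered by inclusion; $w(P)$ denotes the width (maximum size of an antichain) of a poset $P$. -}

module Defs where

open import Level using (0ℓ)
open import Data.Bool using (if_then_else_)
open import Data.Fin using (Fin)
open import Data.Fin.Properties using () renaming (_≟_ to _≟ᶠ_)
open import Data.Fin.Subset
open import Data.Fin.Subset.Properties
open import Data.Integer using (ℤ; 0ℤ; 1ℤ) renaming (_-_ to _-ℤ_)
open import Data.List using (List; _∷_; _∷ʳ_; length)
open import Data.List.Relation.Unary.Linked using (Linked)
open import Data.List.Relation.Unary.Unique.Propositional using (Unique)
open import Data.Nat using (ℕ; _≤_; NonZero)
open import Data.Nat.Properties using (_≟_)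
open import Data.Product using (Σ-syntax; ∃-syntax; _×_; _,_; proj₁)
open import Data.Sum using (_⊎_)
open import Data.Vec using (tabulate)
open import Function using (_⇔_; _∘_)
open import Relation.Binary using (Rel; Poset)
open import Relation.Binary.Construct.Closure.ReflexiveTransitive using (Star)
import Relation.Binary.Construct.On as On
open import Relation.Binary.PropositionalEquality
open import Relation.Nullary using (¬_; does; yes; no; contradiction)
open import Relation.Unary using (Pred; Decidable)

IsMinimum : Pred ℕ 0ℓ → Pred ℕ 0ℓ
IsMinimum P k = P k × (∀ j → P j → k ≤ j)

IsMaximum : Pred ℕ 0ℓ → Pred ℕ 0ℓ
IsMaximum P k = P k × (∀ j → P j → j ≤ k)

comprehension : ∀ {n} {P : Pred (Fin n) 0ℓ} → Decidable P → Subset n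
comprehension P? = tabulate (does ∘ P?)

-- A digraph on the vertex set Fin n is given by its successor sets, that is,
-- by the rows of its adjacency matrix: uv is an edge iff v ∈ D u.
Digraph : ℕ → Set
Digraph n = Fin n → Subset n

Edge : ∀ {n} → Digraph n → Rel (Fin n) 0ℓ
Edge D u v = v ∈ D u

predecessors : ∀ {n} → Digraph n → Fin n → Subset n
predecessors D v = comprehension (λ u → v ∈? D u)

complement : ∀ {n} → Digraph n → Digraph n
complement D u = ∁ (D u)

Matrix : ℕ → Set
Matrix n = Fin n → Fin n → ℤ

adjacencyMatrix : ∀ {n} → Digraph n → Matrix n
adjacencyMatrix D u v = if does (v ∈? D u) then 1ℤ else 0ℤ

allOnes identity : ∀ n → Matrix n
allOnes  n u v = 1ℤ
identity n u v = if does (u ≟ᶠ v) then 1ℤ else 0ℤ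

D[_] : ∀ n → Digraph n
D[ n ] u = ∁ ⁅ u ⁆

adjacencyMatrix-D : ∀ n u v →
  adjacencyMatrix D[ n ] u v ≡ allOnes n u v -ℤ identity n u v
adjacencyMatrix-D n u v with v ∈? D[ n ] u | u ≟ᶠ v
... | yes v∈ | yes refl = contradiction (x∈⁅x⁆ u) (x∈∁p⇒x∉p v∈)
... | yes _  | no _     = refl
... | no _   | yes _    = refl
... | no v∉  | no u≢v   =
  contradiction (sym (x∈⁅y⁆⇒x≡y u (x∉∁p⇒x∈p v∉))) u≢v

Ferrers : ∀ {n} → Digraph n → Set
Ferrers D = ∀ u v → D u ⊆ D v ⊎ D v ⊆ D u

-- The families below are indexed by Fin k and may repeat members; this does
-- not affect the minimum k.

IsIntersection : ∀ {n k} → (Fin k → Digraph n) → Digraph n → Set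
IsIntersection F D = ∀ u v → Edge D u v ⇔ (∀ i → Edge (F i) u v)

IsUnion : ∀ {n k} → (Fin k → Digraph n) → Digraph n → Set
IsUnion F D = ∀ u v → Edge D u v ⇔ (∃[ i ] Edge (F i) u v)

PairwiseDisjoint : ∀ {n k} → (Fin k → Digraph n) → Set
PairwiseDisjoint F = ∀ i j → i ≢ j → ∀ u → Empty (F i u ∩ F j u)

-- f(D) = k
FerrersDimension : ∀ {n} → Digraph n → ℕ → Set
FerrersDimension {n} D = IsMinimum λ k →
  Σ[ F ∈ (Fin k → Digraph n) ] (∀ i → Ferrers (F i)) × IsIntersection F D

-- f*(D) = k
DisjointFerrersDimension : ∀ {n} → Digraph n → ℕ → Set
DisjointFerrersDimension {n} D = IsMinimum λ k →
  Σ[ F ∈ (Fin k → Digraph n) ]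
    (∀ i → Ferrers (F i)) × PairwiseDisjoint F × IsUnion F (complement D)

record Graph (m : ℕ) : Set where
  field
    neighbours : Fin m → Subset m
    symmetric  : ∀ {x y} → y ∈ neighbours x → x ∈ neighbours y
    loopless   : ∀ {x} → x ∉ neighbours x

  Adjacent : Rel (Fin m) 0ℓ
  Adjacent x y = y ∈ neighbours x

  degree : Fin m → ℕ
  degree x = ∣ neighbours x ∣

  leaves : Subset m
  leaves = comprehension (λ x → degree x ≟ 1)

  -- The cycle x, xs, x; it has 1 + length xs ≥ 3 distinct vertices.
  IsCycle : Fin m → List (Fin m) → Set
  IsCycle x xs =
    Linked Adjacent (x ∷ xs ∷ʳ x) × Unique (x ∷ xs) × 2 ≤ length xs

record Tree (m : ℕ) : Set where
  field
    graph : Graph m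

  open Graph graph public

  field
    nonempty  : NonZero m
    connected : ∀ x y → Star Adjacent x y
    acyclic   : ∀ x xs → ¬ IsCycle x xs

record Subtree {m : ℕ} (T : Tree m) : Set where
  open Tree T using (neighbours)
  field
    vertices       : Subset m
    edges          : Fin m → Subset m
    symmetric      : ∀ {x y} → y ∈ edges x → x ∈ edges y
    edges⊆         : ∀ {x} → edges x ⊆ neighbours x
    edges-incident : ∀ {x y} → y ∈ edges x → x ∈ vertices
    nonempty       : Nonempty vertices
    connected      : ∀ {x y} → x ∈ vertices → y ∈ vertices →
                     Star (λ a b → b ∈ edges a) x y

record Representation {n m : ℕ} (D : Digraph n) (T : Tree m) : Set where
  field
    source sink : Fin n → Subtree T
    represents  : ∀ u v →
      Edge D u v ⇔
      Nonempty (Subtree.vertices (source u) ∩ Subtree.vertices (sink v))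

IsCatch : ∀ {n m} {D : Digraph n} {T : Tree m} → Representation D T → Set
IsCatch R = ∀ v → ∃[ x ] Subtree.vertices (Representation.sink R v) ≡ ⁅ x ⁆

-- l(D) = k
Leafage : ∀ {n} → Digraph n → ℕ → Set
Leafage D = IsMinimum λ k →
  ∃[ m ] Σ[ T ∈ Tree m ] ∣ Tree.leaves T ∣ ≡ k × Representation D T

-- l*(D) = k
CatchLeafage : ∀ {n} → Digraph n → ℕ → Set
CatchLeafage D = IsMinimum λ k →
  ∃[ m ] Σ[ T ∈ Tree m ] ∣ Tree.leaves T ∣ ≡ k ×
    (Σ[ R ∈ Representation D T ] IsCatch R)

-- Equality of elements is equality of the underlying subsets, so a set that is
-- the predecessor set of several vertices counts once.
incidencePoset : ∀ {n} → Digraph n → Poset 0ℓ 0ℓ 0ℓ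
incidencePoset {n} D =
  On.poset {B = Σ[ p ∈ Subset n ] ∃[ v ] p ≡ predecessors D v}
           (⊆-poset n) proj₁

-- Members of an antichain are distinct by reflexivity of the order.
Antichain : Poset 0ℓ 0ℓ 0ℓ → ℕ → Set
Antichain P k = Σ[ a ∈ (Fin k → Carrier) ] (∀ i j → i ≢ j → ¬ (a i ≤ᴾ a j))
  where open Poset P renaming (_≤_ to _≤ᴾ_)

-- w(P) = k
Width : Poset 0ℓ 0ℓ 0ℓ → ℕ → Set
Width P = IsMaximum (Antichain P)

{-# OPTIONS --safe #-}

-- Lower bounds. The complement of D[ n ] is the diagonal. A Ferrers digraph
-- containing D[ n ] misses at most one diagonal position, and one contained in
-- the diagonal has at most one edge. In a host tree, for each i some tree edge
-- separates the source of i from the sink of i, cutting the tree into a source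
-- side and a sink side. Since all other pairs of source and sink meet, for i ≢ j
-- either the two source sides or the two sink sides are disjoint, and a third
-- index forces the same alternative for all pairs. So there are n pairwise
-- disjoint sides, and each of them contains a leaf of the tree.
--
-- Upper bounds. The star with n leaves is a host tree: the sink of v is its leaf
-- v, and the source of u is the star without its leaf u.

module Submission where

open import Defs
open import Data.Fin using (Fin; zero; suc; punchIn; punchOut)
open import Data.Fin.Properties
  using (¬∀⟶∃¬; injective⇒≤; punchInᵢ≢i; punchIn-punchOut; punchIn-injective;
         suc-injective)
  renaming (_≟_ to _≟ᶠ_)
open import Data.Fin.Subset renaming (⊥ to ∅)
open import Data.Fin.Subset.Induction using (⊂-wellFounded)
open import Data.Fin.Subset.Properties
open import Data.List using (List; []; _∷_; _∷ʳ_)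
open import Data.List.Membership.Propositional using () renaming (_∈_ to _∈ₗ_)
open import Data.List.Relation.Unary.All using ([]; _∷_)
open import Data.List.Relation.Unary.All.Properties using (¬Any⇒All¬)
open import Data.List.Relation.Unary.AllPairs using ([]; _∷_)
open import Data.List.Relation.Unary.Any using (here; there; any?)
open import Data.List.Relation.Unary.Linked using (Linked; [-]; _∷_)
open import Data.List.Relation.Unary.Unique.Propositional using (Unique)
open import Data.Nat using (ℕ; zero; suc; _≤_; z≤n; s≤s)
open import Data.Nat.Properties using (≤-trans) renaming (_≟_ to _≟ℕ_)
open import Data.Product using (Σ-syntax; ∃-syntax; _×_; _,_; proj₁; proj₂)
open import Data.Sum using (_⊎_; inj₁; inj₂; [_,_]′)
open import Data.Vec using (_∷_; here; there)
open import Data.Vec.Properties using (lookup∘tabulate; lookup⇒[]=; []=⇒lookup)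
open import Function using (_∘_; id; mk⇔; Equivalence)
open import Function.Definitions using (Injective)
open import Induction.WellFounded using (Acc; acc)
open import Level using (0ℓ)
open import Relation.Binary using (Rel)
open import Relation.Binary.Construct.Closure.ReflexiveTransitive using (Star; ε; _◅_; _◅◅_)
open import Relation.Binary.PropositionalEquality
open import Relation.Nullary using (¬_; yes; no; contradiction)
open import Relation.Nullary.Decidable using (decidable-stable; dec-true; dec-false)
open import Relation.Unary using (Pred; Decidable) renaming (_⊥′_ to _⊥_; _⊆_ to _⊆ᵖ_)

open Equivalence using (to; from)

private
  variable
    k m n : ℕ

-- Comprehensions, counting in subsets, and the edges of `D[ n ]`

∈-comprehension⁺ : {P : Pred (Fin n) 0ℓ} (P? : Decidable P) →
  ∀ {x} → P x → x ∈ comprehension P?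
∈-comprehension⁺ P? {x} px =
  lookup⇒[]= x _ (trans (lookup∘tabulate _ x) (dec-true (P? x) px))

∈-comprehension⁻ : {P : Pred (Fin n) 0ℓ} (P? : Decidable P) →
  ∀ {x} → x ∈ comprehension P? → P x
∈-comprehension⁻ P? {x} x∈ =
  decidable-stable (P? x) λ ¬px → contradiction
    (trans (sym (dec-false (P? x) ¬px)) (trans (sym (lookup∘tabulate _ x)) ([]=⇒lookup x∈)))
    λ ()

distinct⇒injective : {A : Set} {f : Fin n → A} →
  (∀ i j → i ≢ j → f i ≢ f j) → Injective _≡_ _≡_ f
distinct⇒injective distinct {i} {j} fi≡fj =
  decidable-stable (i ≟ᶠ j) λ i≢j → distinct i j i≢j fi≡fj

injective-into⇒≤∣∣ : {f : Fin k → Fin n} (p : Subset n) →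
  Injective _≡_ _≡_ f → (∀ i → f i ∈ p) → k ≤ ∣ p ∣
injective-into⇒≤∣∣ {zero}          p inj f∈p = z≤n
injective-into⇒≤∣∣ {suc k} {f = f} p inj f∈p =
  ≤-trans (s≤s (injective-into⇒≤∣∣ (p - f zero) (suc-injective ∘ inj)
                 λ i → x∈p∧x≢y⇒x∈p-y (f∈p (suc i)) λ eq → contradiction (inj eq) λ ()))
          (x∈p⇒∣p-x∣<∣p∣ (f∈p zero))

edge-D⁺ : {u v : Fin n} → u ≢ v → Edge D[ n ] u v
edge-D⁺ u≢v = x∉p⇒x∈∁p (x≢y⇒x∉⁅y⁆ (u≢v ∘ sym))

edge-D⁻ : {u v : Fin n} → Edge D[ n ] u v → u ≢ v
edge-D⁻ {u = u} e refl = x∈∁p⇒x∉p e (x∈⁅x⁆ u)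

-- Ferrers dimension

missesOnly : Fin n → Digraph n
missesOnly i u with u ≟ᶠ i
... | yes _ = ∁ ⁅ i ⁆
... | no  _ = ⊤

missesOnly-ferrers : (i : Fin n) → Ferrers (missesOnly i)
missesOnly-ferrers i u v with u ≟ᶠ i | v ≟ᶠ i
... | yes _ | yes _ = inj₁ id
... | _     | no _  = inj₁ λ _ → ∈⊤
... | no _  | yes _ = inj₂ λ _ → ∈⊤

missesOnly-intersection : IsIntersection missesOnly D[ n ]
missesOnly-intersection {n} u v = mk⇔ ⇒ (λ e → ⇐ (e u))
  where
  ⇒ : Edge D[ n ] u v → ∀ i → Edge (missesOnly i) u v
  ⇒ e i with u ≟ᶠ i
  ... | yes refl = e
  ... | no _     = ∈⊤

  ⇐ : Edge (missesOnly u) u v → Edge D[ n ] u v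
  ⇐ e with u ≟ᶠ u
  ... | yes _  = e
  ... | no u≢u = contradiction refl u≢u

ferrersDimension-D : FerrersDimension D[ n ] n
ferrersDimension-D {n} =
  (missesOnly , missesOnly-ferrers , missesOnly-intersection) , minimal
  where
  minimal : ∀ k → Σ[ F ∈ (Fin k → Digraph n) ]
    (∀ i → Ferrers (F i)) × IsIntersection F D[ n ] → n ≤ k
  minimal k (F , ferrers , ∩F) = injective⇒≤ (distinct⇒injective distinct)
    where
    missing : ∀ v → ∃[ i ] ¬ Edge (F i) v v
    missing v = ¬∀⟶∃¬ k _ (λ i → v ∈? F i v) λ e → edge-D⁻ (from (∩F v v) e) refl

    distinct : ∀ u v → u ≢ v → proj₁ (missing u) ≢ proj₁ (missing v)
    distinct u v u≢v eq with ferrers (proj₁ (missing u)) u v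
    -- Row `u` contains `v` because `uv` is an edge of `D[ n ]`, so its inclusion in row `v` would
    -- restore the missing loop at `v`.
    ... | inj₁ Fu⊆Fv = subst (λ i → ¬ Edge (F i) v v) (sym eq) (proj₂ (missing v))
                         (Fu⊆Fv (to (∩F u v) (edge-D⁺ u≢v) _))
    ... | inj₂ Fv⊆Fu = proj₂ (missing u) (Fv⊆Fu (to (∩F v u) (edge-D⁺ (u≢v ∘ sym)) _))

-- Disjoint Ferrers dimension

loopAt : Fin n → Digraph n
loopAt i u with u ≟ᶠ i
... | yes _ = ⁅ i ⁆
... | no  _ = ∅

loopAt⁻ : (i u : Fin n) {v : Fin n} → Edge (loopAt i) u v → u ≡ i × v ≡ i
loopAt⁻ i u e with u ≟ᶠ i
... | yes u≡i = u≡i , x∈⁅y⁆⇒x≡y i e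
... | no _    = contradiction e ∉⊥

loopAt⁺ : (i : Fin n) → Edge (loopAt i) i i
loopAt⁺ i with i ≟ᶠ i
... | yes _  = x∈⁅x⁆ i
... | no i≢i = contradiction refl i≢i

loopAt-ferrers : (i : Fin n) → Ferrers (loopAt i)
loopAt-ferrers i u v with u ≟ᶠ i | v ≟ᶠ i
... | yes _ | yes _ = inj₁ id
... | no _  | _     = inj₁ λ e → contradiction e ∉⊥
... | yes _ | no _  = inj₂ λ e → contradiction e ∉⊥

loopAt-disjoint : PairwiseDisjoint (loopAt {n})
loopAt-disjoint i j i≢j u (v , v∈) with x∈p∩q⁻ (loopAt i u) (loopAt j u) v∈
... | vᵢ , vⱼ = i≢j (trans (sym (proj₁ (loopAt⁻ i u vᵢ))) (proj₁ (loopAt⁻ j u vⱼ)))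

edge-∁D⁻ : {u v : Fin n} → Edge (complement D[ n ]) u v → u ≡ v
edge-∁D⁻ {u = u} {v} e = decidable-stable (u ≟ᶠ v) (x∈∁p⇒x∉p e ∘ edge-D⁺)

edge-∁D⁺ : (u : Fin n) → Edge (complement D[ n ]) u u
edge-∁D⁺ u = x∉p⇒x∈∁p λ e → edge-D⁻ e refl

loopAt-union : IsUnion loopAt (complement D[ n ])
loopAt-union {n} u v = mk⇔ ⇒ ⇐
  where
  ⇒ : Edge (complement D[ n ]) u v → ∃[ i ] Edge (loopAt i) u v
  ⇒ e with edge-∁D⁻ e
  ... | refl = u , loopAt⁺ u

  ⇐ : ∃[ i ] Edge (loopAt i) u v → Edge (complement D[ n ]) u v
  ⇐ (i , e) with loopAt⁻ i u e
  ... | refl , refl = edge-∁D⁺ i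

disjointFerrersDimension-D : DisjointFerrersDimension D[ n ] n
disjointFerrersDimension-D {n} =
  (loopAt , loopAt-ferrers , loopAt-disjoint , loopAt-union) , minimal
  where
  minimal : ∀ k → Σ[ F ∈ (Fin k → Digraph n) ]
    (∀ i → Ferrers (F i)) × PairwiseDisjoint F × IsUnion F (complement D[ n ]) → n ≤ k
  minimal k (F , ferrers , _ , ∪F) = injective⇒≤ (distinct⇒injective distinct)
    where
    covering : ∀ v → ∃[ i ] Edge (F i) v v
    covering v = to (∪F v v) (edge-∁D⁺ v)

    distinct : ∀ u v → u ≢ v → proj₁ (covering u) ≢ proj₁ (covering v)
    distinct u v u≢v eq with ferrers (proj₁ (covering u)) u v
    -- An inclusion of the rows carries one loop to an edge between distinct vertices, which the
    -- diagonal does not have.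
    ... | inj₁ Fu⊆Fv = u≢v (sym (edge-∁D⁻ (from (∪F v u) (_ , Fu⊆Fv (proj₂ (covering u))))))
    ... | inj₂ Fv⊆Fu = u≢v (edge-∁D⁻ (from (∪F u v) (_ , Fv⊆Fu
                         (subst (λ i → Edge (F i) v v) (sym eq) (proj₂ (covering v))))))

-- Width

∈-predecessors-D⁺ : {u v : Fin n} → u ≢ v → u ∈ predecessors D[ n ] v
∈-predecessors-D⁺ {n} {v = v} u≢v = ∈-comprehension⁺ (λ u → v ∈? D[ n ] u) (edge-D⁺ u≢v)

∈-predecessors-D⁻ : {u v : Fin n} → u ∈ predecessors D[ n ] v → u ≢ v
∈-predecessors-D⁻ {n} {v = v} u∈ = edge-D⁻ (∈-comprehension⁻ (λ u → v ∈? D[ n ] u) u∈)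

width-D : Width (incidencePoset D[ n ]) n
width-D {n} = ((λ v → predecessors D[ n ] v , v , refl) , incomparable) , maximal
  where
  incomparable : ∀ i j → i ≢ j → ¬ (predecessors D[ n ] i ⊆ predecessors D[ n ] j)
  incomparable i j i≢j ⊆ = ∈-predecessors-D⁻ (⊆ (∈-predecessors-D⁺ (i≢j ∘ sym))) refl

  maximal : ∀ k → Antichain (incidencePoset D[ n ]) k → k ≤ n
  -- The vertex of a member determines its predecessor set, so two members with the same vertex
  -- would be comparable.
  maximal k (a , antichain) = injective⇒≤ (distinct⇒injective {f = vertex} λ i j i≢j eq →
    antichain i j i≢j (⊆-reflexive (trans (proj₂ (proj₂ (a i)))
      (trans (cong (predecessors D[ n ]) eq) (sym (proj₂ (proj₂ (a j))))))))
    where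
    vertex : Fin k → Fin n
    vertex i = proj₁ (proj₂ (a i))

-- Branches of a tree

module Branches (T : Tree m) where
  open Tree T

  -- Only the endpoint of each step is tested, so `ε` puts `a` into `Branch b a` and walks can be
  -- concatenated freely.
  Avoiding : Fin m → Rel (Fin m) 0ℓ
  Avoiding b x y = Adjacent x y × y ≢ b

  -- For adjacent a and b, the component of a once the edge ab is removed.
  Branch : Fin m → Fin m → Pred (Fin m) 0ℓ
  Branch b a = Star (Avoiding b) a

  private
    variable
      a b c d x y z : Fin m
      xs : List (Fin m)

  adjacent⇒≢ : Adjacent x y → x ≢ y
  adjacent⇒≢ x~y refl = loopless x~y

  branch-avoids : a ≢ b → Branch b a z → z ≢ b
  branch-avoids a≢b ε              = a≢b
  branch-avoids a≢b ((_ , ≢b) ◅ w) = branch-avoids ≢b w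

  branch-step : Branch b a x → Adjacent x y → y ≢ b → Branch b a y
  branch-step w x~y y≢b = w ◅◅ ((x~y , y≢b) ◅ ε)

  -- The index lists the vertices after the start, the shape in which `IsCycle` takes its vertices.
  data Path (z : Fin m) : Fin m → List (Fin m) → Set where
    []  : Path z z []
    _∷_ : Adjacent x y → Path z y xs → Path z x (y ∷ xs)

  path-linked : Path z x xs → Adjacent z b → Linked Adjacent (x ∷ xs ∷ʳ b)
  path-linked []        z~b = z~b ∷ [-]
  path-linked (x~y ∷ p) z~b = x~y ∷ path-linked p z~b

  path-suffix : Path z x xs → Unique (b ∷ x ∷ xs) → y ∈ₗ x ∷ xs →
    ∃[ ys ] Path z y ys × Unique (b ∷ y ∷ ys)
  path-suffix p       u                  (here refl) = _ , p , u
  path-suffix (_ ∷ p) ((_ ∷ b∉) ∷ _ ∷ u) (there y∈)  = path-suffix p (b∉ ∷ u) y∈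

  -- If `a` recurs on the simple path from `y`, the path is restarted at that occurrence. The vertex
  -- `b` is kept in front because the path will be closed through it.
  erase-loops : a ≢ b → Branch b a z → ∃[ xs ] Path z a xs × Unique (b ∷ a ∷ xs)
  erase-loops a≢b ε = [] , [] , (≢-sym a≢b ∷ []) ∷ [] ∷ []
  erase-loops {a} a≢b (_◅_ {j = y} (a~y , y≢b) w) with erase-loops y≢b w
  ... | ys , p , b∉ ∷ u with any? (a ≟ᶠ_) (y ∷ ys)
  ...   | yes a∈ = path-suffix p (b∉ ∷ u) a∈
  ...   | no a∉  = _ , a~y ∷ p , (≢-sym a≢b ∷ b∉) ∷ ¬Any⇒All¬ _ a∉ ∷ u

  -- Otherwise a simple path from `a` to `z` off `b`, closed through `b`, would be a cycle.
  branch-neighbour : Adjacent a b → Branch b a z → Adjacent z b → a ≡ z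
  branch-neighbour a~b w z~b with erase-loops (adjacent⇒≢ a~b) w
  ... | _ , []    , _ = refl
  ... | _ , p@(_ ∷ _) , u =
    contradiction (symmetric a~b ∷ path-linked p z~b , u , s≤s (s≤s z≤n)) (acyclic _ _)

  -- A step that avoids `b` stays in the branch, so the exit is at `b`, and `a` is the only
  -- neighbour of `b` in the branch.
  branch-exit : Adjacent a b → Branch b a x → Adjacent x y → ¬ Branch b a y → x ≡ a × y ≡ b
  branch-exit {b = b} {y = y} a~b w x~y y∉ with y ≟ᶠ b
  ... | yes refl = sym (branch-neighbour a~b w x~y) , refl
  ... | no y≢b   = contradiction (branch-step w x~y y≢b) y∉

  -- The side is tracked along a walk from `a`: entering the opposite endpoint restarts it by `ε`,
  -- and any other step extends the avoiding walk.
  branches-cover : Adjacent a b → ∀ z → Branch b a z ⊎ Branch a b z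
  branches-cover {a} {b} a~b z = walk (inj₁ ε) (connected a z)
    where
    walk : Branch b a x ⊎ Branch a b x → Star Adjacent x z → Branch b a z ⊎ Branch a b z
    walk side ε = side
    walk (inj₁ x∈) (_◅_ {j = y} x~y w) with y ≟ᶠ b
    ... | yes refl = walk (inj₂ ε) w
    ... | no y≢b   = walk (inj₁ (branch-step x∈ x~y y≢b)) w
    walk (inj₂ x∈) (_◅_ {j = y} x~y w) with y ≟ᶠ a
    ... | yes refl = walk (inj₁ ε) w
    ... | no y≢a   = walk (inj₂ (branch-step x∈ x~y y≢a)) w

  -- A walk from `b` starts outside the branch of `a` and could enter it only at `a`, which it
  -- avoids.
  branches-disjoint : Adjacent a b → Branch b a ⊥ Branch a b
  branches-disjoint {a} {b} a~b z (z∈ , w) =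
    walk (λ b∈ → branch-avoids (adjacent⇒≢ a~b) b∈ refl) w z∈
    where
    walk : ¬ Branch b a x → Star (Avoiding a) x z → ¬ Branch b a z
    walk x∉ ε z∈ = x∉ z∈
    walk x∉ ((x~y , y≢a) ◅ w) = walk
      (λ y∈ → y≢a (proj₁ (branch-exit a~b y∈ (symmetric x~y) x∉))) w

  branch? : Adjacent a b → Decidable (Branch b a)
  branch? a~b z with branches-cover a~b z
  ... | inj₁ z∈ = yes z∈
  ... | inj₂ z∈ = no λ z∈′ → branches-disjoint a~b _ (z∈′ , z∈)

  -- A walk from `a` off `b` never meets `d`, so it prolongs the walk from `c` to `a` off `d`.
  branch-⊆ : ¬ Branch b a d → Branch d c a → Branch b a ⊆ᵖ Branch d c
  branch-⊆ {b} {a} {d} {c} d∉ a∈ = walk ε a∈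
    where
    walk : Branch b a x → Branch d c x → Star (Avoiding b) x z → Branch d c z
    walk x∈ x∈′ ε = x∈′
    walk x∈ x∈′ ((x~y , y≢b) ◅ w) = walk y∈ (branch-step x∈′ x~y λ { refl → d∉ y∈ }) w
      where y∈ = branch-step x∈ x~y y≢b

  -- Of the four quadrants cut out by two edges of a tree one is empty, and x and y
  -- witness that it is not one of the two mixed ones.
  branches-laminar : Adjacent a b → Adjacent c d →
    Branch b a x → Branch c d x → Branch a b y → Branch d c y →
    Branch b a ⊥ Branch d c ⊎ Branch a b ⊥ Branch c d
  branches-laminar {a} {b} {c} {d} a~b c~d x∈₁ x∈₂ y∈₁ y∈₂
    with branches-cover a~b c | branches-cover a~b d
  -- The edge `cd` crosses from the side of `a` to that of `b`, so it is `ab` itself and `x` would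
  -- lie on both sides.
  ... | inj₁ c∈ | inj₂ d∈
    with branch-exit a~b c∈ c~d (λ d∈′ → branches-disjoint a~b _ (d∈′ , d∈))
  ...   | refl , refl = contradiction (x∈₁ , x∈₂) (branches-disjoint a~b _)
  -- Here `cd` is `ab` reversed, and the first alternative speaks of the two sides of `ab`.
  branches-laminar a~b c~d x∈₁ x∈₂ y∈₁ y∈₂ | inj₂ c∈ | inj₁ d∈
    with branch-exit a~b d∈ (symmetric c~d) (λ c∈′ → branches-disjoint a~b _ (c∈′ , c∈))
  ...   | refl , refl = inj₁ (branches-disjoint a~b)
  -- With `c` and `d` both beyond `b`, the branch of `a` lies on one side of `cd`, and `x` rules out
  -- the side of `c`. The last case is the mirror image, with `y` as witness.
  branches-laminar {a} a~b c~d x∈₁ x∈₂ y∈₁ y∈₂ | inj₂ c∈ | inj₂ d∈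
    with branches-cover c~d a
  ... | inj₁ a∈ = contradiction
    (branch-⊆ (λ d∈′ → branches-disjoint a~b _ (d∈′ , d∈)) a∈ x∈₁ , x∈₂) (branches-disjoint c~d _)
  ... | inj₂ a∈ = inj₁ λ _ (z∈₁ , z∈₂) → branches-disjoint c~d _
    (z∈₂ , branch-⊆ (λ c∈′ → branches-disjoint a~b _ (c∈′ , c∈)) a∈ z∈₁)
  branches-laminar {b = b} a~b c~d x∈₁ x∈₂ y∈₁ y∈₂ | inj₁ c∈ | inj₁ d∈
    with branches-cover c~d b
  ... | inj₁ b∈ = inj₂ λ _ (z∈₁ , z∈₂) → branches-disjoint c~d _
    (branch-⊆ (λ d∈′ → branches-disjoint a~b _ (d∈ , d∈′)) b∈ z∈₁ , z∈₂)
  ... | inj₂ b∈ = contradiction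
    (y∈₂ , branch-⊆ (λ c∈′ → branches-disjoint a~b _ (c∈ , c∈′)) b∈ y∈₁) (branches-disjoint c~d _)

  other-neighbour : degree a ≢ 1 → Adjacent a b → ∃[ c ] Adjacent a c × c ≢ b
  other-neighbour {a} {b} deg≢1 a~b with nonempty? (neighbours a ∩ ∁ ⁅ b ⁆)
  ... | yes (c , c∈) = c , proj₁ split , λ { refl → x∈∁p⇒x∉p (proj₂ split) (x∈⁅x⁆ b) }
    where split = x∈p∩q⁻ (neighbours a) (∁ ⁅ b ⁆) c∈
  ... | no none = contradiction (trans (cong ∣_∣ (⊆-antisym ⊆b b⊆)) (∣⁅x⁆∣≡1 b)) deg≢1
    where
    ⊆b : neighbours a ⊆ ⁅ b ⁆
    ⊆b {c} c∈ = x∉∁p⇒x∈p λ c∉ → none (c , x∈p∩q⁺ (c∈ , c∉))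

    b⊆ : ⁅ b ⁆ ⊆ neighbours a
    b⊆ c∈ = subst (_∈ neighbours a) (sym (x∈⁅y⁆⇒x≡y b c∈)) a~b

  -- If `a` is not a leaf, it has a neighbour `c` other than `b`, and the branch of `c` beyond `a`
  -- is smaller: it loses `a`.
  branch-contains-leaf : Adjacent a b → ∃[ x ] x ∈ leaves × Branch b a x
  branch-contains-leaf a~b = descend a~b (⊂-wellFounded _)
    where
    descend : (a~b : Adjacent a b) → Acc _⊂_ (comprehension (branch? a~b)) →
      ∃[ x ] x ∈ leaves × Branch b a x
    descend {a} {b} a~b (acc rec) with degree a ≟ℕ 1
    ... | yes deg≡1 = a , ∈-comprehension⁺ (λ x → degree x ≟ℕ 1) deg≡1 , ε
    ... | no deg≢1 with other-neighbour deg≢1 a~b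
    ...   | c , a~c , c≢b =
      proj₁ leaf-beyond , proj₁ (proj₂ leaf-beyond) , ⊆ (proj₂ (proj₂ leaf-beyond))
      where
      c~a = symmetric a~c

      ⊆ : Branch a c ⊆ᵖ Branch b a
      ⊆ = branch-⊆ (λ b∈ → c≢b (branch-neighbour c~a b∈ (symmetric a~b))) ((a~c , c≢b) ◅ ε)

      ⊂ : comprehension (branch? c~a) ⊂ comprehension (branch? a~b)
      ⊂ = (λ x∈ → ∈-comprehension⁺ (branch? a~b) (⊆ (∈-comprehension⁻ (branch? c~a) x∈)))
        , a , ∈-comprehension⁺ (branch? a~b) ε
        , λ a∈ → branch-avoids (adjacent⇒≢ c~a) (∈-comprehension⁻ (branch? c~a) a∈) refl

      leaf-beyond = descend c~a (rec ⊂)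

  -- Separating disjoint subtrees by an edge

  open Subtree using (vertices)

  record Separation (S S′ : Subtree T) : Set where
    field
      {near far} : Fin m
      edge       : Adjacent near far
      near-side  : ∀ {z} → z ∈ vertices S → Branch far near z
      far-side   : ∀ {z} → z ∈ vertices S′ → Branch near far z

  subtree-in-branch : (S : Subtree T) → a ∈ vertices S → b ∉ vertices S →
    z ∈ vertices S → Branch b a z
  subtree-in-branch {b = b} S a∈ b∉ z∈ = walk (Subtree.connected S a∈ z∈)
    where
    walk : Star (λ x y → y ∈ Subtree.edges S x) x z → Branch b x z
    walk ε = ε
    walk (xy ◅ w) =
      ( Subtree.edges⊆ S xy
      , λ { refl → b∉ (Subtree.edges-incident S (Subtree.symmetric S xy)) }) ◅ walk w

  -- The last exit is taken because the rest of the walk then avoids all of `p`, in particular `a`.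
  -- The second alternative says that the whole walk avoids `p`.
  last-exit : (p : Subset m) → z ∉ p → Star Adjacent x z →
    (∃[ a ] ∃[ b ] Adjacent a b × a ∈ p × b ∉ p × Branch a b z)
      ⊎ (∀ {a} → a ∈ p → a ≢ x × Branch a x z)
  last-exit p z∉ ε = inj₂ λ a∈ → (λ { refl → z∉ a∈ }) , ε
  last-exit {x = x} p z∉ (_◅_ {j = y} x~y w) with last-exit p z∉ w
  ... | inj₁ exit = inj₁ exit
  ... | inj₂ avoids with x ∈? p
  ...   | yes x∈ = inj₁ (x , y , x~y , x∈ , (λ y∈ → proj₁ (avoids y∈) refl) , proj₂ (avoids x∈))
  ...   | no x∉  = inj₂ λ a∈ → (λ { refl → x∉ a∈ })
                 , (x~y , λ { refl → proj₁ (avoids a∈) refl }) ◅ proj₂ (avoids a∈)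

  -- The separating edge is the last one by which a walk from `S` to `S′` leaves `S`. Each subtree
  -- is connected and misses one endpoint, so it stays on its side.
  separate : (S S′ : Subtree T) → ¬ Nonempty (vertices S ∩ vertices S′) → Separation S S′
  separate S S′ disjoint with Subtree.nonempty S | Subtree.nonempty S′
  ... | s , s∈ | t , t∈
    with last-exit (vertices S) (λ t∈S → disjoint (t , x∈p∩q⁺ (t∈S , t∈))) (connected s t)
  ...   | inj₂ avoids = contradiction refl (proj₁ (avoids s∈))
  ...   | inj₁ (a , b , a~b , a∈ , b∉ , t∈branch) = record
    { edge      = a~b
    ; near-side = subtree-in-branch S a∈ b∉
    ; far-side  = λ z∈ → t∈branch ◅◅
        subtree-in-branch S′ t∈ (λ a∈′ → disjoint (a , x∈p∩q⁺ (a∈ , a∈′))) z∈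
    }

-- Leafage

third : (i j : Fin (suc (suc (suc n)))) → ∃[ k ] k ≢ i × k ≢ j
third i j with i ≟ᶠ j
... | yes refl = punchIn i zero , punchInᵢ≢i i zero , punchInᵢ≢i i zero
-- `punchOut i≢j` is the position of `j` once `i` is removed, so `l` skips `j` and `punchIn i` then
-- skips `i`.
... | no i≢j   = punchIn i l , punchInᵢ≢i i l , λ eq →
  punchInᵢ≢i (punchOut i≢j) zero
    (punchIn-injective i l (punchOut i≢j) (trans eq (sym (punchIn-punchOut i≢j))))
  where l = punchIn (punchOut i≢j) zero

module LeafBound {n₃ : ℕ} {T : Tree m} (R : Representation D[ suc (suc (suc n₃)) ] T) where
  open Tree T
  open Branches T
  open Representation R
  open Subtree using (vertices)

  N : ℕ
  N = suc (suc (suc n₃))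

  meet : {i j : Fin N} → i ≢ j → ∃[ z ] z ∈ vertices (source i) × z ∈ vertices (sink j)
  meet {i} {j} i≢j with to (represents i j) (edge-D⁺ i≢j)
  ... | z , z∈ = z , x∈p∩q⁻ (vertices (source i)) (vertices (sink j)) z∈

  separation : ∀ i → Separation (source i) (sink i)
  separation i = separate (source i) (sink i) λ ne → edge-D⁻ (from (represents i i) ne) refl

  module S i = Separation (separation i)

  SourceSide SinkSide : Fin N → Pred (Fin m) 0ℓ
  SourceSide i = Branch (S.far i) (S.near i)
  SinkSide   i = Branch (S.near i) (S.far i)

  -- The two points where the source of one index meets the sink of the other exclude the mixed
  -- quadrants.
  sides-disjoint : ∀ {i j} → i ≢ j → SourceSide i ⊥ SourceSide j ⊎ SinkSide i ⊥ SinkSide j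
  sides-disjoint {i} {j} i≢j with meet i≢j | meet (i≢j ∘ sym)
  ... | x , x∈Sᵢ , x∈Tⱼ | y , y∈Sⱼ , y∈Tᵢ =
    branches-laminar (S.edge i) (S.edge j)
      (S.near-side i x∈Sᵢ) (S.far-side j x∈Tⱼ) (S.far-side i y∈Tᵢ) (S.near-side j y∈Sⱼ)

  -- Otherwise the source of i would lie in the source side of k, off the sink of k.
  not-mixed : ∀ {i j k} → i ≢ k → SourceSide i ⊥ SourceSide j → ¬ SinkSide j ⊥ SinkSide k
  not-mixed {i} {j} {k} i≢k source⊥ sink⊥ with meet i≢k
  ... | z , z∈Sᵢ , z∈Tₖ with branches-cover (S.edge j) z
  ...   | inj₁ z∈ = source⊥ z (S.near-side i z∈Sᵢ , z∈)
  ...   | inj₂ z∈ = sink⊥ z (z∈ , S.far-side k z∈Tₖ)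

  ⊥-sym : {P Q : Pred (Fin m) 0ℓ} → P ⊥ Q → Q ⊥ P
  ⊥-sym P⊥Q x (q , p) = P⊥Q x (p , q)

  SourceType SinkType : Fin N → Set
  SourceType i = ∀ j → i ≢ j → SourceSide i ⊥ SourceSide j
  SinkType   i = ∀ j → i ≢ j → SinkSide i ⊥ SinkSide j

  -- The alternative found for one other index, `punchIn i zero`, is carried to every `j` by
  -- `not-mixed`.
  type : ∀ i → SourceType i ⊎ SinkType i
  type i with sides-disjoint (punchInᵢ≢i i zero ∘ sym)
  ... | inj₁ source⊥ = inj₁ sourceType
    where
    sourceType : SourceType i
    sourceType j i≢j with punchIn i zero ≟ᶠ j | sides-disjoint i≢j
    ... | yes refl | _             = source⊥
    ... | no _     | inj₁ source⊥′ = source⊥′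
    ... | no ≢j    | inj₂ sink⊥    = contradiction sink⊥ (not-mixed ≢j (⊥-sym source⊥))
  ... | inj₂ sink⊥ = inj₂ sinkType
    where
    sinkType : SinkType i
    sinkType j i≢j with punchIn i zero ≟ᶠ j | sides-disjoint i≢j
    ... | yes refl | _            = sink⊥
    ... | no ≢j    | inj₁ source⊥ = contradiction sink⊥ (not-mixed (≢j ∘ sym) (⊥-sym source⊥))
    ... | no _     | inj₂ sink⊥′  = sink⊥′

  types-agree : ∀ {i j} → i ≢ j → SourceType i → ¬ SinkType j
  types-agree {i} {j} i≢j source-i sink-j with third i j
  ... | k , k≢i , k≢j = not-mixed (k≢i ∘ sym) (source-i j i≢j) (sink-j k (k≢j ∘ sym))

  -- By `types-agree` all indices choose the same kind of side.
  chosenSide : Fin N → Pred (Fin m) 0ℓ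
  chosenSide i = [ (λ _ → SourceSide i) , (λ _ → SinkSide i) ]′ (type i)

  chosenSides-disjoint : ∀ {i j} → i ≢ j → chosenSide i ⊥ chosenSide j
  chosenSides-disjoint {i} {j} i≢j with type i | type j
  ... | inj₁ source-i | inj₁ _ = source-i j i≢j
  ... | inj₂ sink-i   | inj₂ _ = sink-i j i≢j
  ... | inj₁ source-i | inj₂ sink-j = contradiction sink-j (types-agree i≢j source-i)
  ... | inj₂ sink-i   | inj₁ source-j = contradiction sink-i (types-agree (i≢j ∘ sym) source-j)

  chosenLeaf : ∀ i → ∃[ x ] x ∈ leaves × chosenSide i x
  chosenLeaf i with type i
  ... | inj₁ _ = branch-contains-leaf (S.edge i)
  ... | inj₂ _ = branch-contains-leaf (symmetric (S.edge i))

  N≤∣leaves∣ : N ≤ ∣ leaves ∣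
  N≤∣leaves∣ = injective-into⇒≤∣∣ leaves
    (distinct⇒injective λ i j i≢j eq → chosenSides-disjoint i≢j _
      ( proj₂ (proj₂ (chosenLeaf i))
      , subst (chosenSide j) (sym eq) (proj₂ (proj₂ (chosenLeaf j)))))
    (proj₁ ∘ proj₂ ∘ chosenLeaf)

leaves-bound : 3 ≤ n → {T : Tree m} → Representation D[ n ] T → n ≤ ∣ Tree.leaves T ∣
leaves-bound (s≤s (s≤s (s≤s _))) R = LeafBound.N≤∣leaves∣ R

-- The star as host tree, with centre `zero` and leaves `suc v`

starNeighbours : Fin (suc n) → Subset (suc n)
starNeighbours zero    = outside ∷ ⊤
starNeighbours (suc _) = ⁅ zero ⁆

starGraph : ∀ n → Graph (suc n)
starGraph n = record
  { neighbours = starNeighbours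
  ; symmetric  = λ {x} {y} → symmetric x y
  ; loopless   = λ {x} → loopless x
  }
  where
  symmetric : ∀ x y → y ∈ starNeighbours x → x ∈ starNeighbours y
  symmetric zero    (suc _) _    = here
  symmetric (suc _) zero    here = there ∈⊤
  symmetric (suc _) (suc _) (there y∈) = contradiction y∈ ∉⊥

  loopless : ∀ x → x ∉ starNeighbours x
  loopless (suc _) (there x∈) = ∉⊥ x∈

module _ {n : ℕ} where
  open Graph (starGraph n)

  ∈⁅zero⁆⇒≡zero : ∀ {y : Fin (suc n)} → y ∈ ⁅ zero ⁆ → y ≡ zero
  ∈⁅zero⁆⇒≡zero = x∈⁅y⁆⇒x≡y zero

  -- Every neighbour of a leaf is the centre, so a closed walk of length at least three repeats the
  -- centre or joins two leaves.
  star-acyclic : ∀ x xs → ¬ IsCycle x xs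
  star-acyclic x [] (_ , _ , ())
  star-acyclic x (_ ∷ []) (_ , _ , s≤s ())
  star-acyclic zero (zero ∷ _ ∷ _) (() ∷ _ , _)
  star-acyclic zero (suc _ ∷ z ∷ _) (_ ∷ y~z ∷ _ , (_ ∷ x≢z ∷ _) ∷ _ , _) =
    x≢z (sym (∈⁅zero⁆⇒≡zero y~z))
  star-acyclic (suc _) (suc _ ∷ _ ∷ _) (x~y ∷ _ , _) = contradiction (∈⁅zero⁆⇒≡zero x~y) λ ()
  star-acyclic (suc _) (zero ∷ zero ∷ _) (_ ∷ () ∷ _ , _)
  star-acyclic (suc _) (zero ∷ suc _ ∷ []) (_ ∷ _ ∷ z~x ∷ _ , _) =
    contradiction (∈⁅zero⁆⇒≡zero z~x) λ ()
  star-acyclic (suc _) (zero ∷ suc _ ∷ w ∷ _) (_ ∷ _ ∷ z~w ∷ _ , _ ∷ (_ ∷ y≢w ∷ _) ∷ _ , _) =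
    y≢w (sym (∈⁅zero⁆⇒≡zero z~w))

star : ∀ n → Tree (suc n)
star n = record
  { graph     = starGraph n
  ; nonempty  = _
  ; connected = λ x y → toCentre x ◅◅ fromCentre y
  ; acyclic   = star-acyclic
  }
  where
  open Graph (starGraph n)
  toCentre : ∀ x → Star Adjacent x zero
  toCentre zero    = ε
  toCentre (suc _) = here ◅ ε

  fromCentre : ∀ y → Star Adjacent zero y
  fromCentre zero    = ε
  fromCentre (suc _) = there ∈⊤ ◅ ε

∣leaves-star∣ : 3 ≤ n → ∣ Tree.leaves (star n) ∣ ≡ n
∣leaves-star∣ {n} (s≤s (s≤s (s≤s _))) = trans (cong ∣_∣ leaves≡) (∣⊤∣≡n n)
  where
  open Tree (star n)
  isLeaf? = λ x → degree x ≟ℕ 1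

  centre∉ : zero ∉ leaves
  -- The match on `3 ≤ n` exposes three successors, so the degree of the centre visibly differs from
  -- 1.
  centre∉ z∈ = contradiction (∈-comprehension⁻ isLeaf? z∈) λ ()

  leaves≡ : leaves ≡ outside ∷ ⊤
  leaves≡ = ⊆-antisym ⇒ ⇐
    where
    ⇒ : leaves ⊆ outside ∷ ⊤
    ⇒ {zero}  x∈ = contradiction x∈ centre∉
    ⇒ {suc _} _  = there ∈⊤

    ⇐ : outside ∷ ⊤ ⊆ leaves
    ⇐ {suc _} _ = ∈-comprehension⁺ isLeaf? (∣⁅x⁆∣≡1 {suc n} zero)

-- The centre is always included, so every set `p` of leaves, even an empty one, gives a connected
-- subgraph.
subStar : Subset n → Subtree (star n)
subStar {n} p = record
  { vertices       = inside ∷ p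
  ; edges          = edges
  ; symmetric      = λ {x} {y} → symmetric x y
  ; edges⊆         = λ {x} → edges⊆ x
  ; edges-incident = λ {x} → edges-incident x
  ; nonempty       = zero , here
  ; connected      = λ x∈ y∈ → toCentre x∈ ◅◅ fromCentre y∈
  }
  where
  edges : Fin (suc n) → Subset (suc n)
  edges zero    = outside ∷ p
  edges (suc i) with i ∈? p
  ... | yes _ = ⁅ zero ⁆
  ... | no  _ = ∅

  toCentre-edge : ∀ {i} → i ∈ p → zero ∈ edges (suc i)
  toCentre-edge {i} i∈ with i ∈? p
  ... | yes _ = here
  ... | no i∉ = contradiction i∈ i∉

  symmetric : ∀ x y → y ∈ edges x → x ∈ edges y
  symmetric zero    (suc _) (there i∈) = toCentre-edge i∈
  symmetric (suc i) y y∈ with i ∈? p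
  ... | no _  = contradiction y∈ ∉⊥
  ... | yes i∈ with x∈⁅y⁆⇒x≡y zero y∈
  ...   | refl = there i∈

  edges⊆ : ∀ x → edges x ⊆ starNeighbours x
  edges⊆ zero    (there _) = there ∈⊤
  edges⊆ (suc i) y∈ with i ∈? p
  ... | yes _ = y∈
  ... | no _  = contradiction y∈ ∉⊥

  edges-incident : ∀ x {y} → y ∈ edges x → x ∈ inside ∷ p
  edges-incident zero    _ = here
  edges-incident (suc i) y∈ with i ∈? p
  ... | yes i∈ = there i∈
  ... | no _   = contradiction y∈ ∉⊥

  toCentre : ∀ {x} → x ∈ inside ∷ p → Star (λ a b → b ∈ edges a) x zero
  toCentre here       = ε
  toCentre (there i∈) = toCentre-edge i∈ ◅ ε

  fromCentre : ∀ {x} → x ∈ inside ∷ p → Star (λ a b → b ∈ edges a) zero x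
  fromCentre here       = ε
  fromCentre (there i∈) = there i∈ ◅ ε

singleVertex : {T : Tree m} → Fin m → Subtree T
singleVertex x = record
  { vertices       = ⁅ x ⁆
  ; edges          = λ _ → ∅
  ; symmetric      = λ y∈ → contradiction y∈ ∉⊥
  ; edges⊆         = λ y∈ → contradiction y∈ ∉⊥
  ; edges-incident = λ y∈ → contradiction y∈ ∉⊥
  ; nonempty       = x , x∈⁅x⁆ x
  ; connected      = λ y∈ z∈ → subst (Star _ _)
      (trans (x∈⁅y⁆⇒x≡y x y∈) (sym (x∈⁅y⁆⇒x≡y x z∈))) ε
  }

starRepresentation : ∀ n → Representation D[ n ] (star n)
starRepresentation n = record
  { source     = λ u → subStar (D[ n ] u)
  ; sink       = λ v → singleVertex (suc v)
  ; represents = λ u v → mk⇔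
      (λ e → suc v , x∈p∩q⁺ {p = inside ∷ D[ n ] u} (there e , x∈⁅x⁆ (suc v))) (⇐ u v)
  }
  where
  ⇐ : ∀ u v → Nonempty ((inside ∷ D[ n ] u) ∩ ⁅ suc v ⁆) → v ∈ D[ n ] u
  ⇐ u v (x , x∈) with x∈p∩q⁻ (inside ∷ D[ n ] u) ⁅ suc v ⁆ x∈
  ... | x∈source , x∈sink with x∈⁅y⁆⇒x≡y (suc v) x∈sink
  ...   | refl = drop-there x∈source

leafage-D : 3 ≤ n → Leafage D[ n ] n
leafage-D {n} 3≤n =
  (suc n , star n , ∣leaves-star∣ 3≤n , starRepresentation n) ,
  λ { _ (_ , T , refl , R) → leaves-bound 3≤n R }

catchLeafage-D : 3 ≤ n → CatchLeafage D[ n ] n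
catchLeafage-D {n} 3≤n =
  (suc n , star n , ∣leaves-star∣ 3≤n , starRepresentation n , λ v → suc v , refl) ,
  λ { _ (_ , T , refl , R , _) → leaves-bound 3≤n R }

mainTheorem7 : (n : ℕ) → 3 ≤ n →
    FerrersDimension D[ n ] n
    × DisjointFerrersDimension D[ n ] n
    × Leafage D[ n ] n
    × CatchLeafage D[ n ] n
    × Width (incidencePoset D[ n ]) n
mainTheorem7 n 3≤n =
  ferrersDimension-D , disjointFerrersDimension-D , leafage-D 3≤n , catchLeafage-D 3≤n , width-D
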